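{- Let $n\ge 1$ be an integer and let $f_n$ be the friendship graph with $n$ triangles. Then $\mathrm{mpd}(f_n)=\infty$.
   Context: The friendship graph $f_n$ has a center $u$ and further vertices $v_1,\dots,v_{2n}$, and is the union of the $n$ triangles $\{u,v_{2i-1},v_{2i}\}$, $1\le i\le n$, which pairwise share only the vertex $u$. $d(u,v)$ denotes the shortest-path distance. Let $G$ be a connected graph and let $\Pi=\{S_1,\dots,S_t\}$ be a partition of $V(G)$ into nonempty parts. For $v\in V(G)$ put $d(v,S_i)=\min\{d(v,x):x\in S_i\}$. The multiset partition representation of $v$ with respect to $\Pi$ is the multiset $r_{mp}(v\mid\Pi)=\{d(v,S_1),\dots,d(v,S_t)\}$ (order ignored, multiplicities kept). $\Pi$ is a resolving multiset partition if $r_{mp}(u\mid\Pi)\ne r_{mp}(v\mid\Pi)$ for all distinct $u,v\in V(G)$. The multiset partition dimension $\mathrm{mpd}(G)$ is the minimum number $t$ of parts of a resolving multiset partition of $G$, and $\mathrm{mpd}(G)=\infty$ if none exists. -}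

module Defs where

open import Data.Fin using (Fin; zero; suc; combine; fromℕ<; toℕ)
open import Data.Fin.Patterns using (0F; 1F)
import Data.Fin.Properties as Fin
open import Data.Fin.Subset using (Subset; _∈_; Nonempty)
open import Data.Fin.Subset.Properties using (_∈?_; nonempty?; anySubset?)
open import Data.List using (List; tabulate)
open import Data.List.Properties using (≡-dec; tabulate-cong)
open import Data.List.Relation.Binary.Equality.Propositional using (≋⇒≡)
open import Data.List.Relation.Binary.Permutation.Propositional
  using (_↭_; ↭-reflexive; ↭-trans; ↭-sym; ↭⇒↭ₛ)
open import Data.List.Relation.Unary.Sorted.TotalOrder.Properties using (↗↭↗⇒≋)
import Data.List.Sort.InsertionSort as InsertionSort
open import Data.Nat using (ℕ; zero; suc; _*_; _≤_; z≤n; s≤s)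
import Data.Nat.Properties as ℕ
open import Data.List.Sort.Base ℕ.≤-totalOrder using (module SortingAlgorithm)
open import Data.Product using (Σ-syntax; ∃; ∃-syntax; _×_; _,_; proj₁; proj₂)
open import Data.Sum using (_⊎_; inj₁; inj₂)
open import Data.Vec using (Vec; []; _∷_; lookup)
open import Function using (_∘_; Injective)
open import Level using (0ℓ)
open import Relation.Binary.PropositionalEquality
  using (_≡_; _≢_; refl; sym; subst)
open import Relation.Nullary using (¬_; Dec; yes; no; contradiction)
open import Relation.Nullary.Construct.Add.Supremum using (_⁺; ⊤⁺; [_])
open import Relation.Nullary.Decidable using (map′; ¬?; _×-dec_; _⊎-dec_; _→-dec_)
open import Relation.Unary using (Pred; Decidable)

IsMinimum : Pred ℕ 0ℓ → ℕ → Set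
IsMinimum P m = P m × (∀ k → P k → m ≤ k)

least : {P : Pred ℕ 0ℓ} → Decidable P → ∀ n → P n → ∃ (IsMinimum P)
least P? zero    P0 = 0 , P0 , λ _ _ → z≤n
least P? (suc n) Pn with P? 0
... | yes P0 = 0 , P0 , λ _ _ → z≤n
... | no ¬P0 with least (P? ∘ suc) n Pn
...   | m , Pm , m≤ = suc m , Pm , λ where
          zero    P0 → contradiction P0 ¬P0
          (suc k) Pk → s≤s (m≤ k Pk)

minimum : {P : Pred ℕ 0ℓ} → Decidable P → ∃ P → ℕ
minimum P? (n , Pn) = proj₁ (least P? n Pn)

minimum-isMinimum : {P : Pred ℕ 0ℓ} (P? : Decidable P) (w : ∃ P) →
                    IsMinimum P (minimum P? w)
minimum-isMinimum P? (n , Pn) = proj₂ (least P? n Pn)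

minimum-irrelevant : {P : Pred ℕ 0ℓ} (P? : Decidable P) (w w′ : ∃ P) →
                     minimum P? w ≡ minimum P? w′
minimum-irrelevant P? w w′ with minimum-isMinimum P? w | minimum-isMinimum P? w′
... | Pm , m≤ | Pm′ , m′≤ = ℕ.≤-antisym (m≤ _ Pm′) (m′≤ _ Pm)

record Graph : Set₁ where
  field
    order  : ℕ
  Vertex : Set
  Vertex = Fin order
  field
    _~_    : Vertex → Vertex → Set
    _~?_   : ∀ x y → Dec (x ~ y)
    ~-sym  : ∀ {x y} → x ~ y → y ~ x
    ~-irrefl : ∀ {x} → ¬ (x ~ x)

module _ (G : Graph) where
  open Graph G

  data Walk : Vertex → Vertex → ℕ → Set where
    []  : ∀ {x} → Walk x x 0
    _∷_ : ∀ {x y z k} → x ~ y → Walk y z k → Walk x z (suc k)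

  walk? : ∀ x y → Decidable (Walk x y)
  walk? x y zero = map′ (λ where refl → []) (λ where [] → refl) (x Fin.≟ y)
  walk? x y (suc k) =
    map′ (λ where (_ , e , w) → e ∷ w) (λ where (e ∷ w) → _ , e , w)
         (Fin.any? λ z → (x ~? z) ×-dec walk? z y k)

  Connected : Set
  Connected = ∀ x y → ∃ (Walk x y)

  record IsPartition {t : ℕ} (Π : Vec (Subset order) t) : Set where
    field
      nonempty : ∀ i → Nonempty (lookup Π i)
      cover    : ∀ v → ∃[ i ] v ∈ lookup Π i
      disjoint : ∀ v i j → v ∈ lookup Π i → v ∈ lookup Π j → i ≡ j

  isPartition? : ∀ {t} (Π : Vec (Subset order) t) → Dec (IsPartition Π)
  isPartition? Π =
    map′ (λ (n , c , d) → record { nonempty = n ; cover = c ; disjoint = d })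
         (λ p → let open IsPartition p in nonempty , cover , disjoint)
         (Fin.all? (λ i → nonempty? (lookup Π i))
           ×-dec Fin.all? (λ v → Fin.any? λ i → v ∈? lookup Π i)
           ×-dec Fin.all? (λ v → Fin.all? λ i → Fin.all? λ j →
                   (v ∈? lookup Π i) →-dec ((v ∈? lookup Π j) →-dec (i Fin.≟ j))))

  parts≤order : ∀ {t} {Π : Vec (Subset order) t} → IsPartition Π → t ≤ order
  parts≤order {Π = Π} p = Fin.injective⇒≤ {f = proj₁ ∘ nonempty} inj
    where
    open IsPartition p
    inj : Injective _≡_ _≡_ (proj₁ ∘ nonempty)
    inj {i} {j} eq = disjoint _ i j (proj₂ (nonempty i))
      (subst (_∈ lookup Π j) (sym eq) (proj₂ (nonempty j)))

↭-dec : (xs ys : List ℕ) → Dec (xs ↭ ys)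
↭-dec xs ys = map′ to from (≡-dec ℕ._≟_ (sort xs) (sort ys))
  where
  open InsertionSort ℕ.≤-decTotalOrder using (insertionSort)
  open SortingAlgorithm insertionSort using (sort; sort-↭; sort-↗)
  to : sort xs ≡ sort ys → xs ↭ ys
  to eq = ↭-trans (↭-sym (sort-↭ xs)) (↭-trans (↭-reflexive eq) (sort-↭ ys))
  from : xs ↭ ys → sort xs ≡ sort ys
  from p = ≋⇒≡ (↗↭↗⇒≋ ℕ.≤-totalOrder (sort-↗ xs) (sort-↗ ys)
    (↭⇒↭ₛ (↭-trans (sort-↭ xs) (↭-trans p (↭-sym (sort-↭ ys))))))

anyVec? : ∀ {n t} {P : Pred (Vec (Subset n) t) 0ℓ} → Decidable P → Dec (∃ P)
anyVec? {t = zero} P? =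
  map′ (λ p → [] , p) (λ where ([] , p) → p) (P? [])
anyVec? {t = suc t} P? =
  map′ (λ where (S , Π , p) → S ∷ Π , p) (λ where (S ∷ Π , p) → S , Π , p)
       (anySubset? λ S → anyVec? λ Π → P? (S ∷ Π))

ℕ∞ : Set
ℕ∞ = ℕ ⁺

∞ : ℕ∞
∞ = ⊤⁺

module _ (G : Graph) (conn : Connected G) where
  open Graph G

  -- A walk of minimum length repeats no vertex, so this is the length of a
  -- shortest path.
  d : Vertex → Vertex → ℕ
  d x y = minimum (walk? G x y) (conn x y)

  AtDistance : Vertex → Subset order → ℕ → Set
  AtDistance v S k = ∃[ x ] x ∈ S × d v x ≡ k

  atDistance? : ∀ v S → Decidable (AtDistance v S)
  atDistance? v S k = Fin.any? λ x → (x ∈? S) ×-dec (d v x ℕ.≟ k)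

  someDistance : ∀ v {S} → Nonempty S → ∃ (AtDistance v S)
  someDistance v (x , x∈S) = d v x , x , x∈S , refl

  dSet : Vertex → (S : Subset order) → Nonempty S → ℕ
  dSet v S ne = minimum (atDistance? v S) (someDistance v ne)

  -- A multiset is a list considered up to _↭_.
  r-mp : ∀ {t} {Π : Vec (Subset order) t} → IsPartition G Π → Vertex → List ℕ
  r-mp {Π = Π} p v = tabulate λ i → dSet v (lookup Π i) (IsPartition.nonempty p i)

  IsResolving : ∀ {t} {Π : Vec (Subset order) t} → IsPartition G Π → Set
  IsResolving p = ∀ x y → x ≢ y → ¬ (r-mp p x ↭ r-mp p y)

  ResolvingMultisetPartition : ∀ {t} → Vec (Subset order) t → Set
  ResolvingMultisetPartition Π = Σ[ p ∈ IsPartition G Π ] IsResolving p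

  HasResolvingMultisetPartition : ℕ → Set
  HasResolvingMultisetPartition t =
    ∃[ Π ] ResolvingMultisetPartition {t} Π

  r-mp-irrelevant : ∀ {t} {Π : Vec (Subset order) t} (p q : IsPartition G Π) v →
                    r-mp p v ≡ r-mp q v
  r-mp-irrelevant p q v = tabulate-cong λ i → minimum-irrelevant (atDistance? v _)
    (someDistance v (IsPartition.nonempty p i)) (someDistance v (IsPartition.nonempty q i))

  resolving? : ∀ {t} (Π : Vec (Subset order) t) → Dec (ResolvingMultisetPartition Π)
  resolving? Π with isPartition? G Π
  ... | no ¬p = no (¬p ∘ proj₁)
  ... | yes p = map′ (p ,_) transfer
      (Fin.all? λ x → Fin.all? λ y →
        ¬? (x Fin.≟ y) →-dec ¬? (↭-dec (r-mp p x) (r-mp p y)))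
    where
    transfer : ResolvingMultisetPartition Π → IsResolving p
    transfer (q , res) x y x≢y eq = res x y x≢y
      (↭-trans (↭-reflexive (r-mp-irrelevant q p x))
        (↭-trans eq (↭-reflexive (r-mp-irrelevant p q y))))

  hasResolving? : Decidable HasResolvingMultisetPartition
  hasResolving? t = anyVec? resolving?

  -- A partition has at most `order` parts, so a bounded search suffices.
  someResolving? : Dec (∃ HasResolvingMultisetPartition)
  someResolving? =
    map′ (λ where (i , h) → toℕ i , h)
         (λ where (t , h@(Π , p , _)) →
                    let t< = s≤s (parts≤order G p)
                    in fromℕ< t< , subst HasResolvingMultisetPartition
                                         (sym (Fin.toℕ-fromℕ< t<)) h)
         (Fin.any? {n = suc order} (hasResolving? ∘ toℕ))

  mpd : ℕ∞
  mpd with someResolving?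
  ... | yes w = [ minimum hasResolving? w ]
  ... | no _  = ∞

module _ (n : ℕ) where

  FVertex : Set
  FVertex = Fin (suc (n * 2))

  center : FVertex
  center = zero

  -- With 0-based i : Fin n, outer i 0F and outer i 1F are v₂ᵢ₊₁ and v₂ᵢ₊₂.
  outer : Fin n → Fin 2 → FVertex
  outer i b = suc (combine i b)

  InTriangle : Fin n → FVertex → Set
  InTriangle i x = x ≡ center ⊎ x ≡ outer i 0F ⊎ x ≡ outer i 1F

  Adjacent : FVertex → FVertex → Set
  Adjacent x y = x ≢ y × ∃[ i ] InTriangle i x × InTriangle i y

  inTriangle? : ∀ i x → Dec (InTriangle i x)
  inTriangle? i x = (x Fin.≟ center) ⊎-dec (x Fin.≟ outer i 0F) ⊎-dec (x Fin.≟ outer i 1F)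

  friendship : Graph
  friendship = record
    { order    = suc (n * 2)
    ; _~_      = Adjacent
    ; _~?_     = λ x y → ¬? (x Fin.≟ y) ×-dec
                   (Fin.any? λ i → inTriangle? i x ×-dec inTriangle? i y)
    ; ~-sym    = λ (x≢y , i , x∈ , y∈) → x≢y ∘ sym , i , y∈ , x∈
    ; ~-irrefl = λ (x≢x , _) → x≢x refl
    }

  outer-inTriangle : ∀ j → ∃[ i ] InTriangle i (suc j)
  outer-inTriangle j with Fin.combine-surjective {n} {2} j
  ... | i , 0F , refl = i , inj₂ (inj₁ refl)
  ... | i , 1F , refl = i , inj₂ (inj₂ refl)

  spoke : ∀ j → Adjacent center (suc j)
  spoke j with outer-inTriangle j
  ... | i , j∈ = (λ ()) , i , inj₁ refl , j∈

  friendship-connected : Connected friendship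
  friendship-connected zero    zero    = 0 , []
  friendship-connected zero    (suc y) = 1 , spoke y ∷ []
  friendship-connected (suc x) zero    = 1 , Graph.~-sym friendship (spoke x) ∷ []
  friendship-connected (suc x) (suc y) = 2 , Graph.~-sym friendship (spoke x) ∷ spoke y ∷ []

{-# OPTIONS --safe #-}

-- The two outer vertices x and y of a triangle are adjacent and have the same
-- other neighbours, so they are equidistant from every part containing neither.
-- If i and j are the indices of the parts of x and y, the representations of x
-- and y therefore agree away from i and j, while at i and j they are exchanged:
-- 0 at the own part, and 1 at the twin's part when it differs.  Hence they are
-- equal as multisets, and no partition is resolving.
module Submission where

open import Defs using (friendship; friendship-connected; mpd; ∞)
open import Data.Nat using (ℕ; _≤_)
open import Relation.Binary.PropositionalEquality using (_≡_)

open import Defs using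
  ( Graph; Walk; []; _∷_; Connected; IsPartition; minimum-isMinimum
  ; d; dSet; atDistance?; someDistance; walk?; r-mp; HasResolvingMultisetPartition
  ; someResolving?; Adjacent; InTriangle; outer )
open import Data.Fin using (Fin; zero; suc; fromℕ<)
open import Data.Fin.Patterns using (0F; 1F)
import Data.Fin.Properties as Fin
open import Data.Fin.Subset using (Subset; _∈_; _∉_; Nonempty)
open import Data.List using (_∷_; tabulate)
open import Data.List.Properties using (tabulate-cong)
open import Data.List.Relation.Binary.Permutation.Propositional
  using (_↭_; ↭-refl; ↭-reflexive; ↭-prep; ↭-swap; module PermutationReasoning)
import Data.Nat.Properties as ℕ
open import Data.Product using (∃-syntax; _×_; _,_; proj₁; proj₂)
open import Data.Sum using (inj₁; inj₂)
open import Data.Vec using (lookup)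
open import Function using (_∘_)
open import Relation.Binary.PropositionalEquality
  using (_≢_; refl; sym; trans; cong; subst)
open import Relation.Nullary using (¬_; yes; no; contradiction)

module _ {a} {A : Set a} where

  -- Each side prepends the entry at `i` that its list lacks, so both consist of `f i`, `g i` and
  -- the common entries. The extra head carries the missing value through the induction.
  tabulate-exchange : ∀ {n} (f g : Fin n → A) i → (∀ k → k ≢ i → f k ≡ g k) →
                      g i ∷ tabulate f ↭ f i ∷ tabulate g
  tabulate-exchange f g zero f≗g =
    ↭-swap _ _ (↭-reflexive (tabulate-cong λ k → f≗g (suc k) λ ()))
  tabulate-exchange f g (suc i) f≗g = begin
    g (suc i) ∷ f zero ∷ tabulate (f ∘ suc)  ↭⟨ ↭-swap _ _ ↭-refl ⟩
    f zero ∷ g (suc i) ∷ tabulate (f ∘ suc)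
      ↭⟨ ↭-prep _ (tabulate-exchange (f ∘ suc) (g ∘ suc) i
           λ k k≢i → f≗g (suc k) (k≢i ∘ Fin.suc-injective)) ⟩
    f zero ∷ f (suc i) ∷ tabulate (g ∘ suc)  ↭⟨ ↭-swap _ _ ↭-refl ⟩
    f (suc i) ∷ f zero ∷ tabulate (g ∘ suc)
      ≡⟨ cong (λ x → f (suc i) ∷ x ∷ tabulate (g ∘ suc)) (f≗g zero λ ()) ⟩
    f (suc i) ∷ tabulate g                   ∎
    where open PermutationReasoning

  tabulate-transpose : ∀ {n} (f g : Fin n → A) i j → f i ≡ g j → f j ≡ g i →
                       (∀ k → k ≢ i → k ≢ j → f k ≡ g k) →
                       tabulate f ↭ tabulate g
  tabulate-transpose f g zero zero fi≡gj fj≡gi f≗g =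
    ↭-reflexive (tabulate-cong {f = f} {g = g} λ where
      zero    → fi≡gj
      (suc k) → f≗g (suc k) (λ ()) (λ ()))
  -- Rewriting turns the heads into `g (suc j)` and `f (suc j)`, which are the values that the two
  -- tails miss at `j`.
  tabulate-transpose f g zero (suc j) fi≡gj fj≡gi f≗g
    rewrite fi≡gj | sym fj≡gi =
    tabulate-exchange (f ∘ suc) (g ∘ suc) j
      λ k k≢j → f≗g (suc k) (λ ()) (k≢j ∘ Fin.suc-injective)
  tabulate-transpose f g (suc i) zero fi≡gj fj≡gi f≗g
    rewrite fj≡gi | sym fi≡gj =
    tabulate-exchange (f ∘ suc) (g ∘ suc) i
      λ k k≢i → f≗g (suc k) (k≢i ∘ Fin.suc-injective) (λ ())
  tabulate-transpose f g (suc i) (suc j) fi≡gj fj≡gi f≗g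
    rewrite f≗g zero (λ ()) (λ ()) =
    ↭-prep _ (tabulate-transpose (f ∘ suc) (g ∘ suc) i j fi≡gj fj≡gi
      λ k k≢i k≢j → f≗g (suc k) (k≢i ∘ Fin.suc-injective) (k≢j ∘ Fin.suc-injective))

-- These are true twins, with equal closed neighbourhoods. The side conditions on `z` leave out the
-- twins themselves, as no vertex is its own neighbour.
record Twins (G : Graph) (x y : Graph.Vertex G) : Set where
  open Graph G
  field
    adjacent : x ~ y
    to       : ∀ {z} → z ≢ y → x ~ z → y ~ z
    from     : ∀ {z} → z ≢ x → y ~ z → x ~ z

module _ {G : Graph} where
  open Graph G

  Twins-sym : ∀ {x y} → Twins G x y → Twins G y x
  Twins-sym t = record { adjacent = ~-sym adjacent ; to = from ; from = to }
    where open Twins t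

  -- Only the first edge has to be redirected to start at `y`. If it leads to `y` already, it is
  -- dropped, so the length may shrink. The condition on `z` rules out the empty walk, which has no
  -- edge to redirect.
  twin-walk : ∀ {x y z k} → Twins G x y → z ≢ x → Walk G x z k →
              ∃[ l ] l ≤ k × Walk G y z l
  twin-walk t z≢x [] = contradiction refl z≢x
  twin-walk {y = y} t z≢x (_∷_ {y = u} e w) with u Fin.≟ y
  ... | yes refl = _ , ℕ.n≤1+n _ , w
  ... | no u≢y   = _ , ℕ.≤-refl , Twins.to t u≢y e ∷ w

module _ {G : Graph} (conn : Connected G) where
  open Graph G

  d-walk : ∀ x y → Walk G x y (d G conn x y)
  d-walk x y = proj₁ (minimum-isMinimum (walk? G x y) (conn x y))

  d-least : ∀ {x y k} → Walk G x y k → d G conn x y ≤ k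
  d-least {x} {y} = proj₂ (minimum-isMinimum (walk? G x y) (conn x y)) _

  d≡0⇒≡ : ∀ {x y} → d G conn x y ≡ 0 → x ≡ y
  d≡0⇒≡ {x} {y} eq with subst (Walk G x y) eq (d-walk x y)
  ... | [] = refl

  twin-d-≤ : ∀ {x y z} → Twins G x y → z ≢ x → d G conn y z ≤ d G conn x z
  twin-d-≤ t z≢x with twin-walk t z≢x (d-walk _ _)
  ... | _ , l≤ , w = ℕ.≤-trans (d-least w) l≤

  module _ {S : Subset order} (ne : Nonempty S) where

    dSet-attained : ∀ x → ∃[ z ] z ∈ S × d G conn x z ≡ dSet G conn x S ne
    dSet-attained x =
      proj₁ (minimum-isMinimum (atDistance? G conn x S) (someDistance G conn x ne))

    dSet-≤ : ∀ x {z} → z ∈ S → dSet G conn x S ne ≤ d G conn x z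
    dSet-≤ x {z} z∈S =
      proj₂ (minimum-isMinimum (atDistance? G conn x S) (someDistance G conn x ne))
        _ (z , z∈S , refl)

    ∈⇒dSet≡0 : ∀ {x} → x ∈ S → dSet G conn x S ne ≡ 0
    ∈⇒dSet≡0 {x} x∈S = ℕ.n≤0⇒n≡0 (ℕ.≤-trans (dSet-≤ x x∈S) (d-least []))

    dSet≡0⇒∈ : ∀ {x} → dSet G conn x S ne ≡ 0 → x ∈ S
    dSet≡0⇒∈ {x} eq with dSet-attained x
    ... | z , z∈S , dz = subst (_∈ S) (sym (d≡0⇒≡ (trans dz eq))) z∈S

    adjacent⇒dSet≡1 : ∀ {x y} → x ~ y → y ∈ S → x ∉ S → dSet G conn x S ne ≡ 1
    adjacent⇒dSet≡1 {x} e y∈S x∉S =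
      -- The edge bounds the distance by 1, and distance 0 would put `x` into `S`.
      ℕ.≤-antisym (ℕ.≤-trans (dSet-≤ x y∈S) (d-least (e ∷ [])))
                  (ℕ.n≢0⇒n>0 (x∉S ∘ dSet≡0⇒∈))

    -- A member of `S` nearest to `x` is not `x` itself, so it is at least as close to `y`.
    twin-dSet-≤ : ∀ {x y} → Twins G x y → x ∉ S →
                  dSet G conn y S ne ≤ dSet G conn x S ne
    twin-dSet-≤ {x} {y} t x∉S with dSet-attained x
    ... | z , z∈S , dz =
      ℕ.≤-trans (dSet-≤ y z∈S)
        (subst (d G conn y z ≤_) dz (twin-d-≤ t λ where refl → x∉S z∈S))

    twin-dSet-≡ : ∀ {x y} → Twins G x y → x ∉ S → y ∉ S →
                  dSet G conn x S ne ≡ dSet G conn y S ne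
    twin-dSet-≡ t x∉S y∉S =
      ℕ.≤-antisym (twin-dSet-≤ (Twins-sym t) y∉S) (twin-dSet-≤ t x∉S)

  twins-r-mp : ∀ {x y t Π} (p : IsPartition G {t} Π) → Twins G x y →
               r-mp G conn p x ↭ r-mp G conn p y
  twins-r-mp {x} {y} {Π = Π} p tw with IsPartition.cover p x | IsPartition.cover p y
  ... | i , x∈i | j , y∈j =
    tabulate-transpose
      (λ k → dSet G conn x (lookup Π k) (nonempty k))
      (λ k → dSet G conn y (lookup Π k) (nonempty k)) i j
      (trans (∈⇒dSet≡0 (nonempty i) x∈i) (sym (∈⇒dSet≡0 (nonempty j) y∈j)))
      crossed
      λ k k≢i k≢j → twin-dSet-≡ (nonempty k) tw
        (λ x∈k → k≢i (disjoint x k i x∈k x∈i))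
        (λ y∈k → k≢j (disjoint y k j y∈k y∈j))
    where
    open IsPartition p
    open Twins tw
    crossed : dSet G conn x (lookup Π j) (nonempty j) ≡
              dSet G conn y (lookup Π i) (nonempty i)
    -- The common value is 0 if the twins share a part and 1 otherwise.
    crossed with i Fin.≟ j
    ... | yes refl = trans (∈⇒dSet≡0 (nonempty i) x∈i) (sym (∈⇒dSet≡0 (nonempty j) y∈j))
    ... | no i≢j   = trans
      (adjacent⇒dSet≡1 (nonempty j) adjacent y∈j (λ x∈j → i≢j (disjoint x i j x∈i x∈j)))
      (sym (adjacent⇒dSet≡1 (nonempty i) (~-sym adjacent) x∈i
        (λ y∈i → i≢j (disjoint y i j y∈i y∈j))))

  twins⇒¬resolving : ∀ {x y} → Twins G x y →
                     ∀ t → ¬ HasResolvingMultisetPartition G conn t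
  twins⇒¬resolving {x} {y} tw t (_ , p , resolves) =
    resolves x y (λ where refl → ~-irrefl (Twins.adjacent tw)) (twins-r-mp p tw)

  ¬resolving⇒mpd≡∞ : (∀ t → ¬ HasResolvingMultisetPartition G conn t) →
                     mpd G conn ≡ ∞
  ¬resolving⇒mpd≡∞ none with someResolving? G conn
  ... | yes (t , h) = contradiction h (none t)
  ... | no _        = refl

module _ {n : ℕ} where

  outer-injective : ∀ {i j b c} → outer n i b ≡ outer n j c → i ≡ j × b ≡ c
  outer-injective = Fin.combine-injective _ _ _ _ ∘ Fin.suc-injective

  outer-triangle : ∀ {i j b} → InTriangle n j (outer n i b) → j ≡ i
  outer-triangle (inj₂ (inj₁ eq)) = sym (proj₁ (outer-injective eq))
  outer-triangle (inj₂ (inj₂ eq)) = sym (proj₁ (outer-injective eq))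

  outer∈triangle : ∀ i b → InTriangle n i (outer n i b)
  outer∈triangle i 0F = inj₂ (inj₁ refl)
  outer∈triangle i 1F = inj₂ (inj₂ refl)

  -- An outer vertex lies in a single triangle, so the triangle witnessing the given adjacency is
  -- `i`, which also contains the other outer vertex. Leaving `b` and `c` free lets one proof serve
  -- both directions of the twin relation.
  outer-neighbour : ∀ i b c {z} → z ≢ outer n i c →
                    Adjacent n (outer n i b) z → Adjacent n (outer n i c) z
  outer-neighbour i b c z≢ (_ , j , x∈ , z∈) with refl ← outer-triangle x∈ =
    z≢ ∘ sym , i , outer∈triangle i c , z∈

  outer-twins : ∀ i → Twins (friendship n) (outer n i 0F) (outer n i 1F)
  outer-twins i = record
    { adjacent = (λ eq → contradiction (proj₂ (outer-injective eq)) λ ())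
               , i , outer∈triangle i 0F , outer∈triangle i 1F
    ; to       = outer-neighbour i 0F 1F
    ; from     = outer-neighbour i 1F 0F
    }

  friendship-mpd≡∞ : Fin n → mpd (friendship n) (friendship-connected n) ≡ ∞
  friendship-mpd≡∞ i =
    ¬resolving⇒mpd≡∞ {G = friendship n} (friendship-connected n)
      (twins⇒¬resolving {G = friendship n} (friendship-connected n) (outer-twins i))

theorem4p3 : ∀ (n : ℕ) → 1 ≤ n → mpd (friendship n) (friendship-connected n) ≡ ∞
-- Positivity of `n` supplies a triangle, namely the one with index 0.
theorem4p3 n 1≤n = friendship-mpd≡∞ (fromℕ< 1≤n)
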